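{- For every fixed integer $r\ge 8$, $$\sup_{\mathsf r(G)=r}\delta(G)=\infty,$$ where the supremum is taken over all finite abelian groups $G$ of rank $r$. Consequently, there is no function $f:\mathbb N\to[0,\infty)$ such that $\delta(G)\le f(\mathsf r(G))$ for every nontrivial finite abelian group $G$, and $\sup_G \delta(G)/\mathsf r(G)=\infty$ even when the supremum is restricted to groups of rank eight. Moreover, for all integers $r\ge 8$ and $m\ge 2$ with $m\ge r$, the group $G_{m,r}=C_m^{\,r-5}\oplus C_{2m}^{\,4}\oplus C_{6m}$ (which has rank $r$) violates the inequality $\delta(G)\le \mathsf r(G)-1$; that is, $\delta(G_{m,r})>r-1$.
   Context: All groups are finite, abelian and written additively; $C_n$ denotes the cyclic group of order $n$. The rank $\mathsf r(G)$ is the minimum number of generators of $G$. A sequence over $G$ is a finite unordered multiset of elements of $G$; its length counts multiplicity. A sequence is zero-sum free if it has no nonempty subsequence (sub-multiset) whose terms sum to $0$. $\mathsf d(G)$ is the maximum length of a zero-sum-free sequence over $G$. If $G\cong C_{n_1}\oplus\cdots\oplus C_{n_s}$ with $1<n_1\mid\cdots\mid n_s$, then $\mathsf d^*(G)=\sum_{i=1}^s(n_i-1)$. The Davenport excess of a nontrivial group is $\delta(G)=\mathsf d(G)-\mathsf d^*(G)$. -}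

module Defs where

open import Algebra.Bundles using (AbelianGroup)
open import Algebra.Morphism.Structures using (module GroupMorphisms)
import Algebra.Construct.DirectProduct as DirectProduct
import Algebra.Construct.Terminal as Terminal
open import Data.Fin.Base using (Fin)
open import Data.Integer.Base as ℤ using (ℤ; +_; 0ℤ)
import Data.Integer.Properties as ℤ
open import Data.Integer.Divisibility.Signed as ℤ∣ using (divides)
open import Data.Integer.Tactic.RingSolver using (solve-∀)
open import Data.List.Base using (List; []; _∷_; [_]; _++_; foldr; length; map; replicate; sum)
open import Data.List.Membership.Propositional using (_∈_)
open import Data.List.Relation.Binary.Sublist.Propositional using (_⊆_)
open import Data.List.Relation.Unary.All using (All)
open import Data.List.Relation.Unary.Linked using (Linked)
open import Data.Nat.Base using (ℕ; pred; _≤_; _<_; _*_; _∸_)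
open import Data.Nat.Divisibility using (_∣_)
open import Data.Product.Base using (∃; ∃₂; _×_; _,_)
open import Data.Rational.Base as ℚ using (ℚ)
open import Data.Sum.Base using (_⊎_)
open import Function.Bundles using (Inverse; _⇔_)
open import Level using (0ℓ; suc; _⊔_)
open import Relation.Binary.PropositionalEquality as ≡ using (_≡_; _≢_; refl; subst)
open import Relation.Nullary.Negation using (¬_)

-- Two-sided Dedekind cuts of ℚ: Lower q means q < x, and Upper q means x < q.
record ℝ : Set₁ where
  field
    Lower         : ℚ → Set
    Upper         : ℚ → Set
    lower-inhab   : ∃ Lower
    upper-inhab   : ∃ Upper
    lower-rounded : ∀ p → Lower p ⇔ (∃ λ q → p ℚ.< q × Lower q)
    upper-rounded : ∀ q → Upper q ⇔ (∃ λ p → p ℚ.< q × Upper p)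
    disjoint      : ∀ q → ¬ (Lower q × Upper q)
    located       : ∀ p q → p ℚ.< q → Lower p ⊎ Upper q

infix 4 _<ᵣ_ _≤ᵣ_

_<ᵣ_ : ℝ → ℚ → Set
x <ᵣ q = ℝ.Upper x q

_≤ᵣ_ : ℚ → ℝ → Set
q ≤ᵣ x = ¬ (x <ᵣ q)

-- sup S = ∞: every real number is exceeded by some member of S.
SupIsInfinite : ∀ {ℓ} → (ℚ → Set ℓ) → Set (suc 0ℓ ⊔ ℓ)
SupIsInfinite S = ∀ (b : ℝ) → ∃ λ q → S q × b <ᵣ q

IsMaximum : (ℕ → Set) → ℕ → Set
IsMaximum P n = P n × (∀ k → P k → k ≤ n)

IsMinimum : (ℕ → Set) → ℕ → Set
IsMinimum P n = P n × (∀ k → P k → n ≤ k)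

AbGroup : Set₁
AbGroup = AbelianGroup 0ℓ 0ℓ

-- The carrier is ℤ; the quotient by nℤ lives in the setoid equality.
-- C 0 is therefore infinite cyclic.
C : ℕ → AbGroup
C n = record
  { Carrier = ℤ
  ; _≈_     = _≋_
  ; _∙_     = ℤ._+_
  ; ε       = 0ℤ
  ; _⁻¹     = ℤ.-_
  ; isAbelianGroup = record
    { isGroup = record
      { isMonoid = record
        { isSemigroup = record
          { isMagma = record
            { isEquivalence = record
              { refl  = λ {x} → reflexive {x} refl
              ; sym   = λ {x} {y} p → subst (+ n ℤ∣.∣_) (sym-eq x y) (ℤ∣.∣m⇒∣-m p)
              ; trans = λ {x} {y} {z} p q →
                  subst (+ n ℤ∣.∣_) (trans-eq x y z) (ℤ∣.∣m∣n⇒∣m+n p q)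
              }
            ; ∙-cong = λ {x} {y} {u} {v} p q →
                subst (+ n ℤ∣.∣_) (cong-eq x y u v) (ℤ∣.∣m∣n⇒∣m+n p q)
            }
          ; assoc = λ x y z → reflexive (ℤ.+-assoc x y z)
          }
        ; identity = (λ x → reflexive (ℤ.+-identityˡ x))
                   , (λ x → reflexive (ℤ.+-identityʳ x))
        }
      ; inverse = (λ x → reflexive (ℤ.+-inverseˡ x))
                , (λ x → reflexive (ℤ.+-inverseʳ x))
      ; ⁻¹-cong = λ {x} {y} p → subst (+ n ℤ∣.∣_) (neg-eq x y) (ℤ∣.∣m⇒∣-m p)
      }
    ; comm = λ x y → reflexive (ℤ.+-comm x y)
    }
  }
  where
  _≋_ : ℤ → ℤ → Set
  x ≋ y = + n ℤ∣.∣ x ℤ.- y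

  reflexive : ∀ {x y} → x ≡ y → x ≋ y
  reflexive {x} refl = divides 0ℤ (ℤ.+-inverseʳ x)

  sym-eq : ∀ x y → ℤ.- (x ℤ.- y) ≡ y ℤ.- x
  sym-eq = solve-∀

  trans-eq : ∀ x y z → (x ℤ.- y) ℤ.+ (y ℤ.- z) ≡ x ℤ.- z
  trans-eq = solve-∀

  cong-eq : ∀ x y u v → (x ℤ.- y) ℤ.+ (u ℤ.- v) ≡ (x ℤ.+ u) ℤ.- (y ℤ.+ v)
  cong-eq = solve-∀

  neg-eq : ∀ x y → ℤ.- (x ℤ.- y) ≡ ℤ.- x ℤ.- ℤ.- y
  neg-eq = solve-∀

⨁C : List ℕ → AbGroup
⨁C ns = foldr DirectProduct.abelianGroup Terminal.abelianGroup (map C ns)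

_≅_ : AbGroup → AbGroup → Set
G ≅ H = ∃ λ f → IsGroupIsomorphism f
  where open GroupMorphisms (AbelianGroup.rawGroup G) (AbelianGroup.rawGroup H)

-- Numerical invariants are given as relations
-- between a group and its value, since extracting the value as a function
-- would require proving its existence for every finite abelian group.
module _ (G : AbGroup) where
  open AbelianGroup G

  IsFinite : Set
  IsFinite = ∃ λ n → Inverse setoid (≡.setoid (Fin n))

  IsNontrivial : Set
  IsNontrivial = ∃ λ x → ¬ (x ≈ ε)

  data ⟨_⟩∋_ (gs : List Carrier) : Carrier → Set where
    gen  : ∀ {x} → x ∈ gs → ⟨ gs ⟩∋ x
    unit : ⟨ gs ⟩∋ ε
    mul  : ∀ {x y} → ⟨ gs ⟩∋ x → ⟨ gs ⟩∋ y → ⟨ gs ⟩∋ (x ∙ y)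
    inv  : ∀ {x} → ⟨ gs ⟩∋ x → ⟨ gs ⟩∋ (x ⁻¹)
    resp : ∀ {x y} → x ≈ y → ⟨ gs ⟩∋ x → ⟨ gs ⟩∋ y

  Generates : List Carrier → Set
  Generates gs = ∀ x → ⟨ gs ⟩∋ x

  HasRank : ℕ → Set
  HasRank = IsMinimum λ k → ∃ λ gs → Generates gs × length gs ≡ k

  total : List Carrier → Carrier
  total = foldr _∙_ ε

  -- A sequence (finite multiset) is represented by a list.  Every
  -- sub-multiset of a list is listed by one of its (order-preserving)
  -- sublists, and totals do not depend on the order, so the choice of
  -- ordering is immaterial.
  ZeroSumFree : List Carrier → Set
  ZeroSumFree S = ∀ {T} → T ⊆ S → T ≢ [] → ¬ (total T ≈ ε)

  -- HasDavenport k, HasDavenport* k and HasExcess k stand for d(G) = k,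
  -- d*(G) = k and δ(G) = k.
  HasDavenport : ℕ → Set
  HasDavenport = IsMaximum λ k → ∃ λ S → ZeroSumFree S × length S ≡ k

  HasDavenport* : ℕ → Set
  HasDavenport* e = ∃ λ ns →
    All (1 <_) ns × Linked _∣_ ns × (G ≅ ⨁C ns) × e ≡ sum (map pred ns)

  HasExcess : ℤ → Set
  HasExcess δ = ∃₂ λ d e → HasDavenport d × HasDavenport* e × δ ≡ + d ℤ.- + e

-- C_m^{r-5} ⊕ C_{2m}^4 ⊕ C_{6m}; meaningful for 5 ≤ r.
G[_,_] : ℕ → ℕ → AbGroup
G[ m , r ] = ⨁C (replicate (r ∸ 5) m ++ replicate 4 (2 * m) ++ [ 6 * m ])

{-# OPTIONS --safe #-}
module Submission where

-- Over C₂⁴ ⊕ C₆, with e₁, …, e₄ of order 2 and g of order 6, the sequence g³ y₁ ⋯ y₄ z₁ z₂ z₃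
-- with yᵢ = eᵢ + 2g, z₁ = e₁ + e₂ + e₃ + 2g, z₂ = e₁ + e₂ + e₄ + 2g and
-- z₃ = e₁ + e₃ + e₄ + 2g is zero-sum free: the eⱼ-parts of the yᵢ and zᵢ are the columns of a
-- parity-check matrix of the [7,3] simplex code, all of whose nonzero words have weight 4, so a
-- nonempty zero-sum subsequence would need 2·4 + k ≡ 0 or k ≡ 0 modulo 6 with 0 ≤ k ≤ 3, and
-- k > 0 in the second case.  Its length is 10 = d*(C₂⁴ ⊕ C₆) + 1, and it has only 8 distinct terms.
-- Multiplication by m maps C_m³ ⊕ C_2m⁴ ⊕ C_6m onto C₂⁴ ⊕ C₆ with kernel C_m⁸, so the 8 terms
-- can be lifted to elements that are independent modulo m.  A zero sum of the lifts then has all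
-- its coefficients divisible by m, and after division by m it is a zero sum of the original
-- terms.  Hence a term of multiplicity c may be given multiplicity cm + (m - 1), for a total
-- length of 10m + 8(m - 1) = d* + m.  Each further summand C_m adds m - 1 to both sides.

open import Defs
open import Algebra.Bundles using (AbelianGroup; CommutativeMonoid)
import Algebra.Construct.DirectProduct as DirectProduct
open import Algebra.Morphism.Construct.Identity using (isGroupIsomorphism)
open import Algebra.Morphism.Structures using (module GroupMorphisms)
import Algebra.Properties.CommutativeMonoid.Mult as CommutativeMonoidMult
import Algebra.Properties.CommutativeSemigroup as CommutativeSemigroupProperties
import Algebra.Properties.Group as GroupProperties
import Algebra.Properties.Monoid.Mult as MonoidMult
open import Data.Fin.Base using (Fin; zero; suc; toℕ; fromℕ<; combine; remQuot; finToFun; funToFin)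
import Data.Fin.Properties as Fin
open import Data.Integer.Base as ℤ using (ℤ; +_; -[1+_]; 0ℤ; 1ℤ)
open import Data.Integer.DivMod using (_%ℕ_; _/ℕ_; n%ℕd<d; a≡a%ℕn+[a/ℕn]*n)
import Data.Integer.Divisibility.Signed as ℤ
import Data.Integer.Properties as ℤ
import Data.Integer.Tactic.RingSolver as ℤSolver
open import Data.List.Base using (List; []; _∷_; [_]; _++_; drop; length; lookup; map; replicate; take)
open import Data.List.Membership.Propositional using (_∈_)
open import Data.List.Membership.Propositional.Properties using (∈-map⁺)
open import Data.List.Properties
  using (length-++; length-drop; length-map; length-replicate; length-take; take++drop≡id)
open import Data.List.Relation.Binary.Sublist.Propositional using (_⊆_; []; _∷_; _∷ʳ_; ⊆-trans)
open import Data.List.Relation.Binary.Sublist.Propositional.Properties using (take-⊆; drop-⊆)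
open import Data.List.Relation.Unary.All as All using (All; []; _∷_)
open import Data.List.Relation.Unary.All.Properties using (++⁺; replicate⁺)
open import Data.List.Relation.Unary.Any using (here; there)
open import Data.List.Relation.Unary.Linked using (Linked; [-]; _∷_)
open import Data.Nat.Base
  using (ℕ; zero; suc; pred; NonZero; >-nonZero; _≤_; _<_; _+_; _*_; _∸_; _⊓_; _^_;
         z≤n; s≤s)
open import Data.Nat.Divisibility
  using (_∣_; _∣?_; divides; divides-refl; ∣-refl; ∣-trans; ∣⇒≤; n∣m*n; ∣n⇒∣m*n;
         ∣m∣n⇒∣m+n; ∣m+n∣m⇒∣n; *-monoˡ-∣; *-cancelʳ-∣)
import Data.Nat.DivMod as ℕ
open import Data.Nat.ListAction using (product; sum)
import Data.Nat.Properties as ℕ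
import Data.Nat.Tactic.RingSolver as ℕSolver
open import Data.Product.Base using (∃; ∃₂; Σ-syntax; _×_; _,_; proj₁; proj₂)
open import Data.Rational.Base as ℚ using (ℚ; mkℚ; 0ℚ; _/_)
import Data.Rational.Properties as ℚ
open import Data.Rational.Unnormalised.Base using (mkℚᵘ; *<*)
import Data.Rational.Unnormalised.Properties as ℚᵘ
open import Data.Sum.Base using (inj₁; inj₂)
open import Data.Unit.Polymorphic.Base using (tt)
open import Data.Vec.Base as Vec using (Vec; []; _∷_)
import Data.Vec.Properties as Vec
open import Data.Vec.Relation.Binary.Pointwise.Inductive using (Pointwise; []; _∷_)
open import Function.Base using (_∘_; const; id)
open import Function.Bundles using (Equivalence; Inverse)
open import Relation.Binary.PropositionalEquality as ≡ using (_≡_; _≢_; refl; sym; trans; cong; cong₂; subst)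
import Relation.Binary.Reasoning.Setoid as SetoidReasoning
open import Relation.Nullary.Decidable
  using (Dec; yes; no; map′; from-yes; ¬?; _×-dec_; _⊎-dec_; _→-dec_)
open import Relation.Nullary.Negation using (¬_; contradiction)
open import Relation.Unary using (Decidable)

-- Bounded search over lists and sublists.

private variable
  A B : Set

anySublist? : {P : List A → Set} → Decidable P → ∀ S → Dec (∃ λ T → T ⊆ S × P T)
anySublist? P? []      = map′ (λ p → [] , [] , p) (λ { ([] , [] , p) → p }) (P? [])
anySublist? P? (x ∷ S) = map′
  (λ { (inj₁ (T , s , p)) → T , x ∷ʳ s , p
     ; (inj₂ (T , s , p)) → x ∷ T , refl ∷ s , p })
  (λ { (T , _ ∷ʳ s , p) → inj₁ (T , s , p)
     ; (_ ∷ T , refl ∷ s , p) → inj₂ (T , s , p) })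
  (anySublist? P? S ⊎-dec anySublist? (P? ∘ (x ∷_)) S)

anyOfLength? : ∀ {n} {P : List (Fin n) → Set} → Decidable P →
               ∀ k → Dec (∃ λ S → P S × length S ≡ k)
anyOfLength? P? zero    = map′ (λ p → [] , p , refl) (λ { ([] , p , refl) → p }) (P? [])
anyOfLength? P? (suc k) = map′
  (λ { (i , S , p , refl) → i ∷ S , p , refl })
  (λ { (i ∷ S , p , refl) → i , S , p , refl })
  (Fin.any? λ i → anyOfLength? (P? ∘ (i ∷_)) k)

-- The search descends from the bound: a value that is not attained lowers the bound by one, and
-- `P 0` stops the descent at zero.
maximum : {P : ℕ → Set} → Decidable P → P 0 → ∀ n → (∀ k → P k → k ≤ n) → ∃ (IsMaximum P)
maximum P? p₀ zero    bound = 0 , p₀ , bound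
maximum P? p₀ (suc n) bound with P? (suc n)
... | yes p = suc n , p , bound
... | no ¬p = maximum P? p₀ n λ k p →
  ℕ.≤-pred (ℕ.≤∧≢⇒< (bound k p) λ { refl → ¬p p })

⊆-map⁻ : ∀ (f : A → B) S {T} → T ⊆ map f S → ∃ λ T′ → T′ ⊆ S × T ≡ map f T′
⊆-map⁻ f []      []         = [] , [] , refl
⊆-map⁻ f (x ∷ S) (_ ∷ʳ s)   with T′ , s′ , refl ← ⊆-map⁻ f S s = T′ , x ∷ʳ s′ , refl
⊆-map⁻ f (x ∷ S) (refl ∷ s) with T′ , s′ , refl ← ⊆-map⁻ f S s = x ∷ T′ , refl ∷ s′ , refl

-- Presents a later suffix as the tail of an earlier one, so that the block of terms between them
-- can be cut out.
drop-drop : ∀ {i j} → i ≤ j → (S : List A) → drop (j ∸ i) (drop i S) ≡ drop j S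
drop-drop z≤n       S       = refl
drop-drop (s≤s i≤j) (x ∷ S) = drop-drop i≤j S
drop-drop {i = suc i} {j = suc j} (s≤s i≤j) [] with j ∸ i
... | zero  = refl
... | suc _ = refl

-- Existence of the Davenport constant of a finite group.

module Davenport (G : AbGroup) (fin : IsFinite G) where
  open AbelianGroup G renaming (refl to ≈-refl; sym to ≈-sym; trans to ≈-trans)
  open GroupProperties group
  open Inverse (proj₂ fin) using (to; from; to-cong; strictlyInverseʳ)

  order : ℕ
  order = proj₁ fin

  _≈?_ : ∀ x y → Dec (x ≈ y)
  x ≈? y = map′
    (λ eq → ≈-trans (≈-sym (strictlyInverseʳ x)) (≈-trans (reflexive (cong from eq)) (strictlyInverseʳ y)))
    to-cong (to x Fin.≟ to y)

  zeroSumFree? : Decidable (ZeroSumFree G)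
  zeroSumFree? S = map′
    (λ none {T} T⊆S T≢[] sum≈ε → none (T , T⊆S , T≢[] , sum≈ε))
    (λ free (T , T⊆S , T≢[] , sum≈ε) → free T⊆S T≢[] sum≈ε)
    (¬? (anySublist? (λ T → nonempty? T ×-dec (total G T ≈? ε)) S))
    where
    nonempty? : (T : List Carrier) → Dec (T ≢ [])
    nonempty? []      = no λ ne → ne refl
    nonempty? (_ ∷ _) = yes λ ()

  total-++ : ∀ S T → total G (S ++ T) ≈ total G S ∙ total G T
  total-++ []      T = ≈-sym (identityˡ _)
  total-++ (x ∷ S) T = ≈-trans (∙-congˡ (total-++ S T)) (≈-sym (assoc _ _ _))

  -- Two of the suffix sums agree, and the terms between them sum to zero.
  zeroSumFree⇒length≤order : ∀ {S} → ZeroSumFree G S → length S ≤ order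
  zeroSumFree⇒length≤order {S} free = ℕ.≮⇒≥ λ order< →
    -- Only the nonempty suffixes are indexed, so `length S` of them compete for `order` values. The
    -- resulting bound is one above the usual one, which is harmless for a search.
    let i , j , i<j , eq = Fin.pigeonhole order< (λ i → to (total G (drop (toℕ i) S)))
        T   = take (toℕ j ∸ toℕ i) (drop (toℕ i) S)
        rest = drop (toℕ j) S
        split : T ++ rest ≡ drop (toℕ i) S
        split = trans (cong (T ++_) (sym (drop-drop (ℕ.<⇒≤ i<j) S)))
                      (take++drop≡id (toℕ j ∸ toℕ i) _)
        sums≈ : total G T ∙ total G rest ≈ ε ∙ total G rest
        sums≈ = begin
          total G T ∙ total G rest      ≈⟨ total-++ T rest ⟨
          total G (T ++ rest)           ≡⟨ cong (total G) split ⟩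
          total G (drop (toℕ i) S)      ≈⟨ strictlyInverseʳ _ ⟨
          from (to (total G (drop (toℕ i) S))) ≡⟨ cong from eq ⟩
          from (to (total G rest))      ≈⟨ strictlyInverseʳ _ ⟩
          total G rest                  ≈⟨ identityˡ _ ⟨
          ε ∙ total G rest              ∎
    in free
      (⊆-trans (take-⊆ (toℕ j ∸ toℕ i) _) (drop-⊆ (toℕ i) S))
      (λ T≡[] → nonempty i j i<j (trans (sym (length-take _ (drop (toℕ i) S))) (cong length T≡[])))
      (∙-cancelʳ _ _ _ sums≈)
    where
    open SetoidReasoning setoid
    nonempty : ∀ (i j : Fin (length S)) → toℕ i < toℕ j →
               (toℕ j ∸ toℕ i) ⊓ length (drop (toℕ i) S) ≢ 0
    nonempty i j i<j eq = ℕ.<⇒≢ (ℕ.⊓-glb (ℕ.m<n⇒0<n∸m i<j)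
      (subst (0 <_) (sym (length-drop (toℕ i) S)) (ℕ.m<n⇒0<n∸m (Fin.toℕ<n i)))) (sym eq)

  total-from-to : ∀ S → total G (map from (map to S)) ≈ total G S
  total-from-to []      = ≈-refl
  total-from-to (x ∷ S) = ∙-cong (strictlyInverseʳ x) (total-from-to S)

  -- The carrier may be infinite, as it is for `C n`. Replacing every term by the chosen
  -- representative of its class brings each sequence within reach of a search over `Fin order`.
  zeroSumFree-from-to : ∀ {S} → ZeroSumFree G S → ZeroSumFree G (map from (map to S))
  zeroSumFree-from-to {S} free T⊆ T≢[] sum≈ε
    with _ , T′⊆ , refl ← ⊆-map⁻ from (map to S) T⊆
    with T , T⊆S , refl ← ⊆-map⁻ to S T′⊆ =
    free T⊆S (λ { refl → T≢[] refl }) (≈-trans (≈-sym (total-from-to T)) sum≈ε)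

  -- A long sequence only bounds d(G) from below, whereas `HasExcess` asks for an actual maximum. It
  -- exists because each length can be tested and the lengths are bounded.
  davenport : ∃ (HasDavenport G)
  davenport = maximum attained? ([] , (λ { [] ne _ → ne refl }) , refl) order
    λ { _ (S , free , refl) → zeroSumFree⇒length≤order free }
    where
    attained? : ∀ k → Dec (∃ λ S → ZeroSumFree G S × length S ≡ k)
    attained? k = map′
      (λ { (S , free , refl) → map from S , (λ {T} → free {T}) , length-map from S })
      (λ { (S , free , refl) → map to S , (λ {T} → zeroSumFree-from-to free {T}) , length-map to S })
      (anyOfLength? (zeroSumFree? ∘ map from) k)

-- Orders of direct sums of cyclic groups.

Sized : AbGroup → ℕ → Set
Sized G n = Inverse (AbelianGroup.setoid G) (≡.setoid (Fin n))

module _ (G : AbGroup) {n : ℕ} where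
  open AbelianGroup G renaming (refl to ≈-refl; sym to ≈-sym; trans to ≈-trans)

  mkSized : (to : Carrier → Fin n) (from : Fin n → Carrier) →
            (∀ {x y} → x ≈ y → to x ≡ to y) →
            (∀ i → to (from i) ≡ i) → (∀ x → from (to x) ≈ x) → Sized G n
  mkSized to from to-cong to∘from from∘to = record
    { to        = to
    ; from      = from
    ; to-cong   = to-cong
    ; from-cong = λ eq → reflexive (cong from eq)
    ; inverse   = (λ {i} eq → trans (to-cong eq) (to∘from i))
                , (λ {x} eq → ≈-trans (reflexive (cong from eq)) (from∘to x))
    }

∣∧<⇒≡0 : ∀ {n k} → n ∣ k → k < n → k ≡ 0
∣∧<⇒≡0 {k = zero}  _   _   = refl
∣∧<⇒≡0 {k = suc _} n∣k k<n = contradiction k<n (ℕ.≤⇒≯ (∣⇒≤ n∣k))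

residue-unique : ∀ {n r s} → r < n → s < n → + n ℤ.∣ + r ℤ.- + s → r ≡ s
residue-unique {n} {r} {s} r<n s<n n∣ =
  ℤ.+-injective (ℤ.i-j≡0⇒i≡j (+ r) (+ s) (ℤ.∣i∣≡0⇒i≡0 (∣∧<⇒≡0 (ℤ.∣⇒∣ᵤ n∣) bound)))
  where
  bound : ℤ.∣ + r ℤ.- + s ∣ < n
  bound = ℕ.≤-<-trans (ℕ.≤-reflexive (cong ℤ.∣_∣ (ℤ.m-n≡m⊖n r s)))
    (ℕ.≤-<-trans (ℤ.∣m⊝n∣≤m⊔n r s) (ℕ.⊔-lub r<n s<n))

C-sized : ∀ n .{{_ : NonZero n}} → Sized (C n) n
C-sized n = mkSized (C n)
  (λ z → fromℕ< (n%ℕd<d z n))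
  (λ i → + toℕ i)
  (λ {x} {y} x≋y → Fin.fromℕ<-cong _ _ (residue-unique (n%ℕd<d x n) (n%ℕd<d y n)
    (subst (+ n ℤ.∣_) (shift (+ (x %ℕ n)) x (+ (y %ℕ n)) y)
      (ℤ.∣m∣n⇒∣m+n (ℤ.∣m∣n⇒∣m+n (residue x) x≋y) (ℤ.∣m⇒∣-m (residue y))))) _ _)
  (λ i → trans (Fin.fromℕ<-cong _ _ (ℕ.m<n⇒m%n≡m (Fin.toℕ<n i)) _ _) (Fin.fromℕ<-toℕ i (Fin.toℕ<n i)))
  (λ z → subst (λ k → + n ℤ.∣ + k ℤ.- z) (sym (Fin.toℕ-fromℕ< (n%ℕd<d z n))) (residue z))
  where
  shift : ∀ r x s y → (r ℤ.- x) ℤ.+ (x ℤ.- y) ℤ.+ ℤ.- (s ℤ.- y) ≡ r ℤ.- s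
  shift = ℤSolver.solve-∀
  cancel : ∀ r q d → r ℤ.- (r ℤ.+ q ℤ.* d) ≡ ℤ.- q ℤ.* d
  cancel = ℤSolver.solve-∀
  residue : ∀ z → + n ℤ.∣ + (z %ℕ n) ℤ.- z
  residue z = ℤ.divides (ℤ.- (z /ℕ n))
    (trans (cong (λ w → + (z %ℕ n) ℤ.- w) (a≡a%ℕn+[a/ℕn]*n z n)) (cancel (+ (z %ℕ n)) (z /ℕ n) (+ n)))

⨁C-sized : ∀ {ns} → All NonZero ns → Sized (⨁C ns) (product ns)
⨁C-sized {[]}     []            =
  mkSized (⨁C []) {1} (const zero) (const tt) (const refl) (λ { zero → refl }) (const tt)
⨁C-sized {n ∷ ns} (n≢0 ∷ ns≢0) = mkSized (⨁C (n ∷ ns))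
  (λ (x , y) → combine (F.to x) (H.to y))
  (λ i → F.from (proj₁ (remQuot {n} (product ns) i)) , H.from (proj₂ (remQuot {n} (product ns) i)))
  (λ { {x , y} {x′ , y′} (p , q) → cong₂ combine (F.to-cong {x} {x′} p) (H.to-cong {y} {y′} q) })
  (λ i → trans (cong₂ combine (F.strictlyInverseˡ _) (H.strictlyInverseˡ _)) (Fin.combine-remQuot {n} (product ns) i))
  (λ (x , y) →
      subst (λ p → AbelianGroup._≈_ (C n) (F.from (proj₁ p)) x) (sym (split x y)) (F.strictlyInverseʳ x)
    , subst (λ p → AbelianGroup._≈_ (⨁C ns) (H.from (proj₂ p)) y) (sym (split x y)) (H.strictlyInverseʳ y))
  where
  module F = Inverse (C-sized n {{n≢0}})
  module H = Inverse (⨁C-sized ns≢0)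

  split : ∀ x y → remQuot {n} (product ns) (combine (F.to x) (H.to y)) ≡ (F.to x , H.to y)
  split x y = Fin.remQuot-combine (F.to x) (H.to y)

product-replicate : ∀ r m → product (replicate r m) ≡ m ^ r
product-replicate zero    m = refl
product-replicate (suc r) m = cong (m *_) (product-replicate r m)

-- Counting the elements generated in a group of bounded exponent.

Exponent : ℕ → AbGroup → Set
Exponent m G = ∀ x → m · x ≈ ε
  where
  open AbelianGroup G
  open MonoidMult monoid using () renaming (_×_ to _·_)

module _ (G : AbGroup) {m : ℕ} (exponent : Exponent (suc m) G) where
  open AbelianGroup G renaming (refl to ≈-refl; sym to ≈-sym; trans to ≈-trans)
  open GroupProperties group
  open MonoidMult monoid using (×-congʳ; ×-congˡ; ×-homo-+; ×-homo-1; ×-assocˡ) renaming (_×_ to _·_)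
  open CommutativeMonoidMult commutativeMonoid using (×-distrib-+)
  open CommutativeSemigroupProperties (CommutativeMonoid.commutativeSemigroup commutativeMonoid) using (interchange)
  open SetoidReasoning setoid

  combination : (gs : List Carrier) → (Fin (length gs) → ℕ) → Carrier
  combination []       c = ε
  combination (g ∷ gs) c = c zero · g ∙ combination gs (c ∘ suc)

  combination-cong : ∀ gs {c d} → (∀ i → c i · lookup gs i ≈ d i · lookup gs i) →
                     combination gs c ≈ combination gs d
  combination-cong []       c≈d = ≈-refl
  combination-cong (g ∷ gs) c≈d = ∙-cong (c≈d zero) (combination-cong gs (c≈d ∘ suc))

  combination-0 : ∀ gs → combination gs (const 0) ≈ ε
  combination-0 []       = ≈-refl
  combination-0 (g ∷ gs) = ≈-trans (identityˡ _) (combination-0 gs)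

  combination-∙ : ∀ gs c d → combination gs c ∙ combination gs d ≈ combination gs (λ i → c i + d i)
  combination-∙ []       c d = identityˡ ε
  combination-∙ (g ∷ gs) c d = begin
    (c zero · g ∙ combination gs (c ∘ suc)) ∙ (d zero · g ∙ combination gs (d ∘ suc))
      ≈⟨ interchange _ _ _ _ ⟩
    (c zero · g ∙ d zero · g) ∙ (combination gs (c ∘ suc) ∙ combination gs (d ∘ suc))
      ≈⟨ ∙-cong (≈-sym (×-homo-+ g (c zero) (d zero))) (combination-∙ gs (c ∘ suc) (d ∘ suc)) ⟩
    combination (g ∷ gs) (λ i → c i + d i) ∎

  combination-· : ∀ gs n c → n · combination gs c ≈ combination gs (λ i → n * c i)
  combination-· []       zero    c = ≈-refl
  combination-· []       (suc n) c = ≈-trans (identityˡ _) (combination-· [] n c)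
  combination-· (g ∷ gs) n       c = begin
    n · (c zero · g ∙ combination gs (c ∘ suc))     ≈⟨ ×-distrib-+ _ _ n ⟩
    n · c zero · g ∙ n · combination gs (c ∘ suc)   ≈⟨ ∙-cong (×-assocˡ g n (c zero))
                                                              (combination-· gs n (c ∘ suc)) ⟩
    combination (g ∷ gs) (λ i → n * c i)            ∎

  ∈⇒combination : ∀ {gs x} → x ∈ gs → ∃ λ c → x ≈ combination gs c
  ∈⇒combination {g ∷ gs} (here refl) = (λ { zero → 1 ; (suc _) → 0 }) , (begin
    g                                   ≈⟨ identityʳ g ⟨
    g ∙ ε                               ≈⟨ ∙-cong (×-homo-1 g) (combination-0 gs) ⟨
    1 · g ∙ combination gs (const 0)    ∎)
  ∈⇒combination {g ∷ gs} {x} (there x∈) with c , eq ← ∈⇒combination x∈ =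
    (λ { zero → 0 ; (suc i) → c i }) , (begin
    x                         ≈⟨ eq ⟩
    combination gs c          ≈⟨ identityˡ _ ⟨
    ε ∙ combination gs c      ∎)

  -- Natural coefficients suffice: since `suc m` annihilates the group, the inverse of `x` is
  -- `m · x`.
  generated⇒combination : ∀ {gs x} → (⟨ G ⟩∋ gs) x → ∃ λ c → x ≈ combination gs c
  generated⇒combination      (gen x∈) = ∈⇒combination x∈
  generated⇒combination {gs} unit     = const 0 , ≈-sym (combination-0 gs)
  generated⇒combination {gs} (mul p q)
    with c , x≈ ← generated⇒combination p | d , y≈ ← generated⇒combination q =
    (λ i → c i + d i) , ≈-trans (∙-cong x≈ y≈) (combination-∙ gs c d)
  generated⇒combination {gs} (inv {x} p) with c , x≈ ← generated⇒combination p =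
    (λ i → m * c i) , (begin
    x ⁻¹                              ≈⟨ inverseʳ-unique x (m · x) (exponent x) ⟨
    m · x                             ≈⟨ ×-congʳ m x≈ ⟩
    m · combination gs c              ≈⟨ combination-· gs m c ⟩
    combination gs (λ i → m * c i)    ∎)
  generated⇒combination (resp x≈y p) with c , x≈ ← generated⇒combination p =
    c , ≈-trans (≈-sym x≈y) x≈

  ·-% : ∀ n x → n · x ≈ (n ℕ.% suc m) · x
  ·-% n x = begin
    n · x                              ≈⟨ ×-congˡ (trans (ℕ.m≡m%n+[m/n]*n n (suc m))
                                            (cong (λ t → r + t) (ℕ.*-comm q (suc m)))) ⟩
    (r + suc m * q) · x                ≈⟨ ×-homo-+ x r (suc m * q) ⟩
    r · x ∙ (suc m * q) · x            ≈⟨ ∙-congˡ (×-assocˡ x (suc m) q) ⟨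
    r · x ∙ suc m · q · x              ≈⟨ ∙-congˡ (exponent (q · x)) ⟩
    r · x ∙ ε                          ≈⟨ identityʳ _ ⟩
    r · x                              ∎
    where
    r = n ℕ.% suc m
    q = n ℕ./ suc m

  -- Coefficients matter only modulo `suc m`, so an element is recovered from its tuple of residues,
  -- one residue for each generator. Sending elements to tuples is therefore injective.
  generates⇒size≤ : ∀ {N gs} → Sized G N → Generates G gs → N ≤ suc m ^ length gs
  generates⇒size≤ {N} {gs} sized generates = Fin.injective⇒≤ {f = code} code-injective
    where
    open Inverse sized using (to; from; to-cong; strictlyInverseˡ)

    coefficients : Fin N → Fin (length gs) → ℕ
    coefficients i = proj₁ (generated⇒combination (generates (from i)))

    residues : Fin N → Fin (length gs) → Fin (suc m)
    residues i j = coefficients i j ℕ.mod suc m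

    code : Fin N → Fin (suc m ^ length gs)
    code i = funToFin (residues i)

    decode : Fin (suc m ^ length gs) → Carrier
    decode k = combination gs (toℕ ∘ finToFun k)

    decode-code : ∀ i → from i ≈ decode (code i)
    decode-code i = begin
      from i                                 ≈⟨ proj₂ (generated⇒combination (generates (from i))) ⟩
      combination gs (coefficients i)        ≈⟨ combination-cong gs (λ j → ≈-trans (·-% (coefficients i j) _)
                                                  (×-congˡ (sym (residue j)))) ⟩
      decode (code i)                        ∎
      where
      residue : ∀ j → toℕ (finToFun (code i) j) ≡ coefficients i j ℕ.% suc m
      residue j = trans (cong toℕ (Fin.finToFun-funToFin (residues i) j)) (Fin.toℕ-fromℕ< _)

    code-injective : ∀ {i j} → code i ≡ code j → i ≡ j
    code-injective {i} {j} eq = trans (sym (strictlyInverseˡ i)) (trans (to-cong (begin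
      from i           ≈⟨ decode-code i ⟩
      decode (code i)  ≡⟨ cong decode eq ⟩
      decode (code j)  ≈⟨ decode-code j ⟨
      from j           ∎)) (strictlyInverseˡ j))

-- Homomorphic images and reduction modulo m.

module _ (G H : AbGroup) where
  private
    module G = AbelianGroup G
    module H = AbelianGroup H
  open GroupMorphisms G.rawGroup H.rawGroup

  map-generated : ∀ {f} → IsGroupHomomorphism f →
                  ∀ {gs x} → (⟨ G ⟩∋ gs) x → (⟨ H ⟩∋ map f gs) (f x)
  map-generated {f} hom = go
    where
    open IsGroupHomomorphism hom
    go : ∀ {gs x} → (⟨ G ⟩∋ gs) x → (⟨ H ⟩∋ map f gs) (f x)
    go (gen x∈)   = gen (∈-map⁺ f x∈)
    go unit       = resp (H.sym ε-homo) unit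
    go (mul p q)  = resp (H.sym (homo _ _)) (mul (go p) (go q))
    go (inv p)    = resp (H.sym (⁻¹-homo _)) (inv (go p))
    go (resp e p) = resp (⟦⟧-cong e) (go p)

  generates-map : ∀ {f} → IsGroupHomomorphism f → (∀ y → ∃ λ x → f x H.≈ y) →
                  ∀ {gs} → Generates G gs → Generates H (map f gs)
  generates-map hom surjective generates y with x , fx≈y ← surjective y =
    resp fx≈y (map-generated hom (generates x))

module _ (m : ℕ) where
  -- The projection onto C_m^r for r the number of summands. Each summand has carrier ℤ on both
  -- sides, so the integers stay as they are and only the equality becomes coarser, which is where m
  -- must divide every modulus.
  reduce : ∀ ns → AbelianGroup.Carrier (⨁C ns) → AbelianGroup.Carrier (⨁C (replicate (length ns) m))
  reduce []       tt      = tt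
  reduce (n ∷ ns) (x , y) = x , reduce ns y

  unreduce : ∀ ns y → ∃ λ x → AbelianGroup._≈_ (⨁C (replicate (length ns) m)) (reduce ns x) y
  unreduce []       tt      = tt , tt
  unreduce (n ∷ ns) (x , y) with y′ , eq ← unreduce ns y = (x , y′) , AbelianGroup.refl (C m) {x} , eq

  reduce-homomorphism : ∀ {ns} → All (m ∣_) ns →
    GroupMorphisms.IsGroupHomomorphism (AbelianGroup.rawGroup (⨁C ns))
      (AbelianGroup.rawGroup (⨁C (replicate (length ns) m))) (reduce ns)
  reduce-homomorphism {ns} m∣ns = record
    { isMonoidHomomorphism = record
      { isMagmaHomomorphism = record
        { isRelHomomorphism = record { cong = reduce-cong m∣ns }
        ; homo = reduce-∙ ns }
      ; ε-homo = reduce-ε ns }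
    ; ⁻¹-homo = reduce-⁻¹ ns }
    where
    module G ns = AbelianGroup (⨁C ns)
    module H ns = AbelianGroup (⨁C (replicate (length ns) m))

    reduce-cong : ∀ {ns} → All (m ∣_) ns → ∀ {x y} → G._≈_ ns x y → H._≈_ ns (reduce ns x) (reduce ns y)
    reduce-cong []            _       = tt
    reduce-cong (m∣n ∷ m∣ns)  (p , q) = ℤ.∣-trans (ℤ.∣ᵤ⇒∣ m∣n) p , reduce-cong m∣ns q

    reduce-∙ : ∀ ns x y → H._≈_ ns (reduce ns (G._∙_ ns x y)) (H._∙_ ns (reduce ns x) (reduce ns y))
    reduce-∙ []       _       _         = tt
    reduce-∙ (n ∷ ns) (x , y) (x′ , y′) = AbelianGroup.refl (C m) {x ℤ.+ x′} , reduce-∙ ns y y′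

    reduce-ε : ∀ ns → H._≈_ ns (reduce ns (G.ε ns)) (H.ε ns)
    reduce-ε []       = tt
    reduce-ε (n ∷ ns) = AbelianGroup.refl (C m) {0ℤ} , reduce-ε ns

    reduce-⁻¹ : ∀ ns x → H._≈_ ns (reduce ns (G._⁻¹ ns x)) (H._⁻¹ ns (reduce ns x))
    reduce-⁻¹ []       _       = tt
    reduce-⁻¹ (n ∷ ns) (x , y) = AbelianGroup.refl (C m) {ℤ.- x} , reduce-⁻¹ ns y

module _ (n : ℕ) where
  open MonoidMult (AbelianGroup.monoid (C n)) using () renaming (_×_ to _·_)

  C-· : ∀ k x → k · x ≡ + k ℤ.* x
  C-· zero    x = sym (ℤ.*-zeroˡ x)
  C-· (suc k) x = trans (cong (λ y → x ℤ.+ y) (C-· k x)) (sym (ℤ.suc-* (+ k) x))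

C-exponent : ∀ n → Exponent n (C n)
C-exponent n x = ℤ.divides x (trans (ℤ.+-identityʳ _) (trans (C-· n n x) (ℤ.*-comm (+ n) x)))

module _ (G H : AbGroup) where
  private
    G×H = DirectProduct.abelianGroup G H
    module G = MonoidMult (AbelianGroup.monoid G)
    module H = MonoidMult (AbelianGroup.monoid H)
    module G×H = MonoidMult (AbelianGroup.monoid G×H)

  ·-× : ∀ n x y → n G×H.× (x , y) ≡ (n G.× x , n H.× y)
  ·-× zero    x y = refl
  ·-× (suc n) x y = cong (AbelianGroup._∙_ G×H (x , y)) (·-× n x y)

  ×-exponent : ∀ {n} → Exponent n G → Exponent n H → Exponent n G×H
  ×-exponent {n} expG expH (x , y) =
    AbelianGroup.trans G×H (AbelianGroup.reflexive G×H (·-× n x y)) (expG x , expH y)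

⨁C-exponent : ∀ r n → Exponent n (⨁C (replicate r n))
⨁C-exponent zero    n = const tt
⨁C-exponent (suc r) n = ×-exponent (C n) (⨁C (replicate r n)) {n} (C-exponent n) (⨁C-exponent r n)

-- Modulo m, k generators yield at most m ^ k of the m ^ length ns elements.
generates⇒length≤ : ∀ {m ns} → 1 < m → All (m ∣_) ns →
                    ∀ {gs} → Generates (⨁C ns) gs → length ns ≤ length gs
generates⇒length≤ {m@(suc _)} {ns} 1<m m∣ns {gs} generates = ℕ.≮⇒≥ λ gs<ns →
  ℕ.<⇒≱ (ℕ.^-monoʳ-< m 1<m gs<ns)
    (subst (λ k → m ^ r ≤ m ^ k) (length-map (reduce m ns) gs)
      (generates⇒size≤ K (⨁C-exponent r m) sized
        (generates-map (⨁C ns) K (reduce-homomorphism m m∣ns) (unreduce m ns) generates)))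
  where
  r = length ns
  K = ⨁C (replicate r m)
  sized : Sized K (m ^ r)
  sized = subst (Sized K) (product-replicate r m) (⨁C-sized (replicate⁺ r _))

-- Rank and d* of a direct sum of cyclic groups.

basis : ∀ ns → List (AbelianGroup.Carrier (⨁C ns))
basis []       = []
basis (n ∷ ns) = (1ℤ , AbelianGroup.ε (⨁C ns)) ∷ map (0ℤ ,_) (basis ns)

length-basis : ∀ ns → length (basis ns) ≡ length ns
length-basis []       = refl
length-basis (n ∷ ns) = cong suc (trans (length-map _ (basis ns)) (length-basis ns))

basis-generates : ∀ ns → Generates (⨁C ns) (basis ns)
basis-generates []       tt      = unit
basis-generates (n ∷ ns) (z , y) =
  resp (reflexive′ (ℤ.+-identityʳ z) , H.identityˡ y) (mul (multiple z) (second (basis-generates ns y)))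
  where
  module H = AbelianGroup (⨁C ns)
  G = ⨁C (n ∷ ns)
  reflexive′ : ∀ {x y} → x ≡ y → AbelianGroup._≈_ (C n) x y
  reflexive′ = AbelianGroup.reflexive (C n)
  second : ∀ {y} → (⟨ ⨁C ns ⟩∋ basis ns) y → (⟨ G ⟩∋ basis (n ∷ ns)) (0ℤ , y)
  second (gen y∈)   = gen (there (∈-map⁺ (0ℤ ,_) y∈))
  second unit       = unit
  second (mul p q)  = mul (second p) (second q)
  second (inv p)    = inv (second p)
  second (resp e p) = resp (reflexive′ {0ℤ} refl , e) (second p)
  natural : ∀ k → (⟨ G ⟩∋ basis (n ∷ ns)) (+ k , H.ε)
  natural zero    = unit
  natural (suc k) = resp (reflexive′ {+ suc k} refl , H.identityˡ H.ε) (mul (gen (here refl)) (natural k))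
  multiple : ∀ z → (⟨ G ⟩∋ basis (n ∷ ns)) (z , H.ε)
  multiple (+ k)    = natural k
  multiple -[1+ k ] = resp (reflexive′ { -[1+ k ]} refl , GroupProperties.ε⁻¹≈ε H.group) (inv (natural (suc k)))

⨁C-rank : ∀ {m ns} → 1 < m → All (m ∣_) ns → HasRank (⨁C ns) (length ns)
⨁C-rank {ns = ns} 1<m m∣ns =
    (basis ns , basis-generates ns , length-basis ns)
  , λ { _ (gs , generates , refl) → generates⇒length≤ 1<m m∣ns generates }

⨁C-davenport* : ∀ {ns} → All (1 <_) ns → Linked _∣_ ns → HasDavenport* (⨁C ns) (sum (map pred ns))
⨁C-davenport* {ns} 1<ns chain =
  ns , 1<ns , chain , (id , isGroupIsomorphism G.rawGroup G.refl) , refl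
  where module G = AbelianGroup (⨁C ns)

⨁C-nontrivial : ∀ {n} ns → 1 < n → IsNontrivial (⨁C (n ∷ ns))
⨁C-nontrivial ns 1<n = (1ℤ , AbelianGroup.ε (⨁C ns)) , λ (n∣1 , _) → ℕ.<⇒≱ 1<n (∣⇒≤ (ℤ.∣⇒∣ᵤ n∣1))

-- Sequences x₁^a₁ ⋯ x_k^a_k and their sums.

powers : ∀ {k} → Vec ℕ k → Vec A k → List A
powers []       []       = []
powers (a ∷ as) (x ∷ xs) = replicate a x ++ powers as xs

length-powers : ∀ {k} (as : Vec ℕ k) (xs : Vec A k) → length (powers as xs) ≡ Vec.sum as
length-powers []       []       = refl
length-powers (a ∷ as) (x ∷ xs) =
  trans (length-++ (replicate a x)) (cong₂ _+_ (length-replicate a) (length-powers as xs))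

⊆-replicate-++ : ∀ k {x : A} {S T} → T ⊆ replicate k x ++ S →
                 ∃₂ λ a T′ → a ≤ k × T′ ⊆ S × T ≡ replicate a x ++ T′
⊆-replicate-++ zero    s          = 0 , _ , z≤n , s , refl
⊆-replicate-++ (suc k) (_ ∷ʳ s)   with a , T′ , a≤k , s′ , eq ← ⊆-replicate-++ k s =
  a , T′ , ℕ.m≤n⇒m≤1+n a≤k , s′ , eq
⊆-replicate-++ (suc k) (refl ∷ s) with a , T′ , a≤k , s′ , refl ← ⊆-replicate-++ k s =
  suc a , T′ , s≤s a≤k , s′ , refl

-- Equal copies stand together, so only the number kept of each term matters. Subsequences thereby
-- become vectors of multiplicities.
⊆-powers : ∀ {k} (ks : Vec ℕ k) (xs : Vec A k) {T} → T ⊆ powers ks xs →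
           ∃ λ as → Pointwise _≤_ as ks × T ≡ powers as xs
⊆-powers []       []       []  = [] , [] , refl
⊆-powers (k ∷ ks) (x ∷ xs) s
  with a , _ , a≤k , s′ , refl ← ⊆-replicate-++ k s
  with as , as≤ks , refl ← ⊆-powers ks xs s′ = a ∷ as , a≤k ∷ as≤ks , refl

infix 8 _∙ᵥ_
_∙ᵥ_ : ∀ {k} → Vec ℕ k → Vec ℕ k → ℕ
[]       ∙ᵥ []       = 0
(c ∷ cs) ∙ᵥ (a ∷ as) = c * a + cs ∙ᵥ as

∙ᵥ-scale : ∀ {k} (cs as : Vec ℕ k) m → cs ∙ᵥ Vec.map (_* m) as ≡ cs ∙ᵥ as * m
∙ᵥ-scale []       []       m = refl
∙ᵥ-scale (c ∷ cs) (a ∷ as) m = trans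
  (cong₂ _+_ (sym (ℕ.*-assoc c a m)) (∙ᵥ-scale cs as m))
  (sym (ℕ.*-distribʳ-+ m (c * a) (cs ∙ᵥ as)))

module _ (G : AbGroup) where
  open AbelianGroup G using (Carrier; _∙_; ε)

  -- Sums are formed on integer representatives, so each coordinate of a sum is exactly an integer
  -- linear form in the multiplicities. Congruences enter only afterwards, through `≋0⇒∣`.
  coordinate-total-powers :
    (π : Carrier → ℤ) → (∀ x y → π (x ∙ y) ≡ π x ℤ.+ π y) → π ε ≡ 0ℤ →
    ∀ {k} (cs as : Vec ℕ k) (xs : Vec Carrier k) → Pointwise (λ c x → π x ≡ + c) cs xs →
    π (total G (powers as xs)) ≡ + (cs ∙ᵥ as)
  coordinate-total-powers π π-∙ π-ε = go
    where
    go : ∀ {k} (cs as : Vec ℕ k) (xs : Vec Carrier k) → Pointwise (λ c x → π x ≡ + c) cs xs →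
         π (total G (powers as xs)) ≡ + (cs ∙ᵥ as)
    step : ∀ {k c} (cs : Vec ℕ k) a as {x} xs → π x ≡ + c → Pointwise (λ c x → π x ≡ + c) cs xs →
           π (total G (replicate a x ++ powers as xs)) ≡ + (c * a + cs ∙ᵥ as)
    go []       []       []       []          = π-ε
    go (c ∷ cs) (a ∷ as) (x ∷ xs) (eq ∷ eqs)  = step cs a as xs eq eqs
    step {c = c} cs zero    as xs eq eqs =
      trans (go cs as xs eqs) (cong (λ n → + (n + cs ∙ᵥ as)) (sym (ℕ.*-zeroʳ c)))
    step {c = c} cs (suc a) as xs eq eqs =
      trans (π-∙ _ _) (trans (cong₂ ℤ._+_ eq (step cs a as xs eq eqs)) (cong +_
        (trans (sym (ℕ.+-assoc c (c * a) _)) (cong (_+ cs ∙ᵥ as) (sym (ℕ.*-suc c a))))))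

≋0⇒∣ : ∀ {n i k} → i ≡ + k → + n ℤ.∣ i ℤ.- 0ℤ → n ∣ k
≋0⇒∣ {n} {_} {k} refl p = subst (n ∣_) (ℕ.+-identityʳ k) (ℤ.∣⇒∣ᵤ p)

-- Adding a cyclic summand.

module _ (n : ℕ) (ns : List ℕ) where
  private
    G = ⨁C (n ∷ ns)
    H = ⨁C ns
    module H = AbelianGroup H

  withUnits : List H.Carrier → List (AbelianGroup.Carrier G)
  withUnits S = replicate (pred n) (1ℤ , H.ε) ++ map (0ℤ ,_) S

  length-withUnits : ∀ S → length (withUnits S) ≡ pred n + length S
  length-withUnits S = trans (length-++ (replicate (pred n) _))
    (cong₂ _+_ (length-replicate (pred n)) (length-map _ S))

  private
    total₁ : ∀ a T → proj₁ (total G (replicate a (1ℤ , H.ε) ++ map (0ℤ ,_) T)) ≡ + a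
    total₁ zero    []      = refl
    total₁ zero    (x ∷ T) = trans (ℤ.+-identityˡ _) (total₁ zero T)
    total₁ (suc a) T       = cong (λ i → 1ℤ ℤ.+ i) (total₁ a T)

    total₂ : ∀ T → proj₂ (total G (map (0ℤ ,_) T)) ≡ total H T
    total₂ []      = refl
    total₂ (x ∷ T) = cong (x H.∙_) (total₂ T)

  -- The first coordinate of a subsequence sum counts the copies of the new generator, of which
  -- there are at most n - 1. A zero sum thus contains none of them and comes from a subsequence of
  -- `S`.
  withUnits-zeroSumFree : .{{_ : NonZero n}} → ∀ {S} → ZeroSumFree H S → ZeroSumFree G (withUnits S)
  withUnits-zeroSumFree {S} free T⊆ T≢[] (p , q)
    with a , _ , a≤ , s , refl ← ⊆-replicate-++ (pred n) T⊆
    with T , T⊆S , refl ← ⊆-map⁻ (0ℤ ,_) S s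
    with refl ← ∣∧<⇒≡0 (≋0⇒∣ {n} (total₁ a T) p) (ℕ.m≤pred[n]⇒suc[m]≤n a≤) =
    free T⊆S (λ { refl → T≢[] refl }) (H.trans (H.reflexive (sym (total₂ T))) q)

-- cᵢ ∙ᵥ v is the i-th coordinate of the sum in which z₁, z₂, z₃, y₁, y₂, y₃, y₄, g have the
-- multiplicities v.
c₁ c₂ c₃ c₄ c₅ c₆ c₇ c₈ : Vec ℕ 8
c₁ = 1 ∷ 0 ∷ 0 ∷ 0 ∷ 0 ∷ 0 ∷ 0 ∷ 0 ∷ []
c₂ = 0 ∷ 1 ∷ 0 ∷ 0 ∷ 0 ∷ 0 ∷ 0 ∷ 0 ∷ []
c₃ = 0 ∷ 0 ∷ 1 ∷ 0 ∷ 0 ∷ 0 ∷ 0 ∷ 0 ∷ []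
c₄ = 1 ∷ 1 ∷ 1 ∷ 1 ∷ 0 ∷ 0 ∷ 0 ∷ 0 ∷ []
c₅ = 1 ∷ 1 ∷ 0 ∷ 0 ∷ 1 ∷ 0 ∷ 0 ∷ 0 ∷ []
c₆ = 1 ∷ 0 ∷ 1 ∷ 0 ∷ 0 ∷ 1 ∷ 0 ∷ 0 ∷ []
c₇ = 0 ∷ 1 ∷ 1 ∷ 0 ∷ 0 ∷ 0 ∷ 1 ∷ 0 ∷ []
c₈ = 2 ∷ 2 ∷ 2 ∷ 2 ∷ 2 ∷ 2 ∷ 2 ∷ 1 ∷ []

-- Abstract, since its uses must not unfold the check of all 512 cases.
abstract
  base-zeroSumFree :
    ∀ {b₁} → b₁ < 2 → ∀ {b₂} → b₂ < 2 → ∀ {b₃} → b₃ < 2 →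
    ∀ {a₁} → a₁ < 2 → ∀ {a₂} → a₂ < 2 → ∀ {a₃} → a₃ < 2 → ∀ {a₄} → a₄ < 2 →
    ∀ {c} → c < 4 → let v = b₁ ∷ b₂ ∷ b₃ ∷ a₁ ∷ a₂ ∷ a₃ ∷ a₄ ∷ c ∷ [] in
    2 ∣ c₄ ∙ᵥ v → 2 ∣ c₅ ∙ᵥ v → 2 ∣ c₆ ∙ᵥ v → 2 ∣ c₇ ∙ᵥ v → 6 ∣ c₈ ∙ᵥ v →
    v ≡ Vec.replicate 8 0
  base-zeroSumFree = from-yes
    (below 2 λ b₁ → below 2 λ b₂ → below 2 λ b₃ → below 2 λ a₁ → below 2 λ a₂ → below 2 λ a₃ →
     below 2 λ a₄ → below 4 λ c → let v = b₁ ∷ b₂ ∷ b₃ ∷ a₁ ∷ a₂ ∷ a₃ ∷ a₄ ∷ c ∷ [] in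
     2 ∣? c₄ ∙ᵥ v →-dec 2 ∣? c₅ ∙ᵥ v →-dec 2 ∣? c₆ ∙ᵥ v →-dec 2 ∣? c₇ ∙ᵥ v →-dec 6 ∣? c₈ ∙ᵥ v →-dec
     Vec.≡-dec ℕ._≟_ v (Vec.replicate 8 0))
    where
    below : ∀ {P : ℕ → Set} v → (∀ n → Dec (P n)) → Dec (∀ {n} → n < v → P n)
    below v P? = ℕ.allUpTo? P? v

-- The lifted sequence in rank eight.

invariantFactors₈ : ℕ → List ℕ
invariantFactors₈ m = m ∷ m ∷ m ∷ 2 * m ∷ 2 * m ∷ 2 * m ∷ 2 * m ∷ 6 * m ∷ []

module RankEight (m : ℕ) .{{_ : NonZero m}} where
  private
    G = ⨁C (invariantFactors₈ m)
    open AbelianGroup G using (Carrier; _≈_; ε)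

  -- An original multiplicity c becomes cm + (m - 1) = (c + 1)m - 1. The entries 2 and 4 are c + 1
  -- for c = 1 and c = 3.
  multiplicities : Vec ℕ 8
  multiplicities = Vec.map (λ k → pred (k * m)) (2 ∷ 2 ∷ 2 ∷ 2 ∷ 2 ∷ 2 ∷ 2 ∷ 4 ∷ [])

  private
    term : (z₁ z₂ z₃ y₁ y₂ y₃ y₄ g : ℕ) → Carrier
    term z₁ z₂ z₃ y₁ y₂ y₃ y₄ g = + z₁ , + z₂ , + z₃ , + y₁ , + y₂ , + y₃ , + y₄ , + g , tt

  -- The last five coordinates copy the terms over C₂⁴ ⊕ C₆; the first three, in C_m³, mark z₁, z₂,
  -- z₃. The rows form an upper triangular matrix with ones on the diagonal, whence the independence
  -- modulo `m`.
  terms : Vec Carrier 8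
  terms =
      term 1 0 0 1 1 1 0 2
    ∷ term 0 1 0 1 1 0 1 2
    ∷ term 0 0 1 1 0 1 1 2
    ∷ term 0 0 0 1 0 0 0 2
    ∷ term 0 0 0 0 1 0 0 2
    ∷ term 0 0 0 0 0 1 0 2
    ∷ term 0 0 0 0 0 0 1 2
    ∷ term 0 0 0 0 0 0 0 1 ∷ []

  sequence : List Carrier
  sequence = powers multiplicities terms

  relations : ∀ as → total G (powers as terms) ≈ ε →
    (m ∣ c₁ ∙ᵥ as × m ∣ c₂ ∙ᵥ as × m ∣ c₃ ∙ᵥ as) ×
    2 * m ∣ c₄ ∙ᵥ as × 2 * m ∣ c₅ ∙ᵥ as × 2 * m ∣ c₆ ∙ᵥ as × 2 * m ∣ c₇ ∙ᵥ as × 6 * m ∣ c₈ ∙ᵥ as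
  relations as (p₁ , p₂ , p₃ , p₄ , p₅ , p₆ , p₇ , p₈ , _) =
    ( ≋0⇒∣ (coordinate (λ (x , _) → x) (λ _ _ → refl) refl c₁ as terms eqs) p₁
    , ≋0⇒∣ (coordinate (λ (_ , x , _) → x) (λ _ _ → refl) refl c₂ as terms eqs) p₂
    , ≋0⇒∣ (coordinate (λ (_ , _ , x , _) → x) (λ _ _ → refl) refl c₃ as terms eqs) p₃ )
    , ≋0⇒∣ (coordinate (λ (_ , _ , _ , x , _) → x) (λ _ _ → refl) refl c₄ as terms eqs) p₄
    , ≋0⇒∣ (coordinate (λ (_ , _ , _ , _ , x , _) → x) (λ _ _ → refl) refl c₅ as terms eqs) p₅
    , ≋0⇒∣ (coordinate (λ (_ , _ , _ , _ , _ , x , _) → x) (λ _ _ → refl) refl c₆ as terms eqs) p₆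
    , ≋0⇒∣ (coordinate (λ (_ , _ , _ , _ , _ , _ , x , _) → x) (λ _ _ → refl) refl c₇ as terms eqs) p₇
    , ≋0⇒∣ (coordinate (λ (_ , _ , _ , _ , _ , _ , _ , x , _) → x) (λ _ _ → refl) refl c₈ as terms eqs) p₈
    where
    coordinate = coordinate-total-powers G
    -- A pattern synonym, because the same eight `refl`s prove a different statement for each
    -- coordinate.
    pattern eqs = refl ∷ refl ∷ refl ∷ refl ∷ refl ∷ refl ∷ refl ∷ refl ∷ []

  -- Back substitution modulo `m`: the first three coordinates isolate the multiplicities of the zᵢ,
  -- and every later coordinate contains one new multiplicity, with coefficient 1, beside
  -- multiplicities already known to be divisible.
  solution-divisible : ∀ as → total G (powers as terms) ≈ ε → ∃ λ bs → as ≡ Vec.map (_* m) bs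
  solution-divisible as@(b₁ ∷ b₂ ∷ b₃ ∷ a₁ ∷ a₂ ∷ a₃ ∷ a₄ ∷ c ∷ []) eq
    with (r₁ , r₂ , r₃) , r₄ , r₅ , r₆ , r₇ , r₈ ← relations as eq =
    vec (single r₁ , single r₂ , single r₃ , d₄ , d₅ , d₆ , d₇ , d₈)
    where
    single : ∀ {k} → m ∣ k + 0 + 0 → m ∣ k
    single {k} = subst (m ∣_) (trans (ℕ.+-identityʳ (k + 0)) (ℕ.+-identityʳ k))
    d₁ = single r₁
    d₂ = single r₂
    d₃ = single r₃
    _⊕_ : ∀ {i j} → m ∣ i → m ∣ j → m ∣ i + j
    _⊕_ = ∣m∣n⇒∣m+n
    infixl 6 _⊕_
    -- Weakens the modulus `k * m` to `m` and subtracts the known part `l`, leaving the new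
    -- multiplicity `n`.
    last : ∀ k {i j} → k * m ∣ i → i ≡ j → ∀ {l} → m ∣ l → ∀ {n} → j ≡ l + n → m ∣ n
    last k p refl q refl = ∣m+n∣m⇒∣n (∣-trans (n∣m*n k) p) q
    eq₄ : ∀ x y z w → (x + 0) + ((y + 0) + ((z + 0) + ((w + 0) + 0))) ≡ x + y + z + w
    eq₄ = ℕSolver.solve-∀
    eq₃ : ∀ x y z → (x + 0) + ((y + 0) + ((z + 0) + 0)) ≡ x + y + z
    eq₃ = ℕSolver.solve-∀
    eq₈ : ∀ x y z t u v w c →
      2 * x + (2 * y + (2 * z + (2 * t + (2 * u + (2 * v + (2 * w + (1 * c + 0))))))) ≡
      2 * (x + y + z + t + u + v + w) + c
    eq₈ = ℕSolver.solve-∀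
    d₄ = last 2 r₄ (eq₄ b₁ b₂ b₃ a₁) (d₁ ⊕ d₂ ⊕ d₃) refl
    d₅ = last 2 r₅ (eq₃ b₁ b₂ a₂) (d₁ ⊕ d₂) refl
    d₆ = last 2 r₆ (eq₃ b₁ b₃ a₃) (d₁ ⊕ d₃) refl
    d₇ = last 2 r₇ (eq₃ b₂ b₃ a₄) (d₂ ⊕ d₃) refl
    d₈ = last 6 r₈ (eq₈ b₁ b₂ b₃ a₁ a₂ a₃ a₄ c) (∣n⇒∣m*n 2 (d₁ ⊕ d₂ ⊕ d₃ ⊕ d₄ ⊕ d₅ ⊕ d₆ ⊕ d₇)) refl
    vec : ∀ {b₁ b₂ b₃ a₁ a₂ a₃ a₄ c} →
      (m ∣ b₁ × m ∣ b₂ × m ∣ b₃ × m ∣ a₁ × m ∣ a₂ × m ∣ a₃ × m ∣ a₄ × m ∣ c) →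
      ∃ λ bs → b₁ ∷ b₂ ∷ b₃ ∷ a₁ ∷ a₂ ∷ a₃ ∷ a₄ ∷ c ∷ [] ≡ Vec.map (_* m) bs
    vec (divides-refl b₁ , divides-refl b₂ , divides-refl b₃ , divides-refl a₁ , divides-refl a₂ ,
         divides-refl a₃ , divides-refl a₄ , divides-refl c) =
      b₁ ∷ b₂ ∷ b₃ ∷ a₁ ∷ a₂ ∷ a₃ ∷ a₄ ∷ c ∷ [] , refl

  private
    bound : ∀ b k .{{_ : NonZero k}} → b * m ≤ pred (k * m) → b < k
    bound b k le = ℕ.*-cancelʳ-< m b k (ℕ.m≤pred[n]⇒suc[m]≤n {{ℕ.m*n≢0 k m}} le)

    cancel : ∀ k (cs bs : Vec ℕ 8) → k * m ∣ cs ∙ᵥ Vec.map (_* m) bs → k ∣ cs ∙ᵥ bs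
    cancel k cs bs p = *-cancelʳ-∣ m (subst (k * m ∣_) (∙ᵥ-scale cs bs m) p)

  -- Division by `m` turns the bound (c + 1)m - 1 into c and the moduli 2m and 6m into 2 and 6, so
  -- what remains is the finite check over C₂⁴ ⊕ C₆.
  solution-trivial : ∀ bs → Pointwise _≤_ (Vec.map (_* m) bs) multiplicities →
                     total G (powers (Vec.map (_* m) bs) terms) ≈ ε → bs ≡ Vec.replicate 8 0
  solution-trivial bs@(b₁ ∷ b₂ ∷ b₃ ∷ a₁ ∷ a₂ ∷ a₃ ∷ a₄ ∷ c ∷ [])
    (l₁ ∷ l₂ ∷ l₃ ∷ l₄ ∷ l₅ ∷ l₆ ∷ l₇ ∷ l₈ ∷ []) sum≈ε =
    let _ , r₄ , r₅ , r₆ , r₇ , r₈ = relations (Vec.map (_* m) bs) sum≈ε in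
    base-zeroSumFree (bound b₁ 2 l₁) (bound b₂ 2 l₂) (bound b₃ 2 l₃) (bound a₁ 2 l₄)
      (bound a₂ 2 l₅) (bound a₃ 2 l₆) (bound a₄ 2 l₇) (bound c 4 l₈)
      (cancel 2 c₄ bs r₄) (cancel 2 c₅ bs r₅) (cancel 2 c₆ bs r₆) (cancel 2 c₇ bs r₇) (cancel 6 c₈ bs r₈)

  sequence-zeroSumFree : ZeroSumFree G sequence
  sequence-zeroSumFree T⊆ T≢[] sum≈ε
    with as , as≤ , refl ← ⊆-powers multiplicities terms T⊆
    with bs , refl ← solution-divisible as sum≈ε =
    -- When all eight multiplicities vanish, `powers` computes to the empty list.
    T≢[] (cong (λ bs → powers (Vec.map (_* m) bs) terms) (solution-trivial bs as≤ sum≈ε))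

  -- The length is 7(2m - 1) + (4m - 1) = 18m - 8, while d* = 3(m - 1) + 4(2m - 1) + (6m - 1) = 17m
  -- - 8.
  length-sequence : length sequence ≡ sum (map pred (invariantFactors₈ m)) + m
  length-sequence = trans (length-powers multiplicities terms) (count m)
    where
    count : ∀ m .{{_ : NonZero m}} →
      Vec.sum (Vec.map (λ k → pred (k * m)) (2 ∷ 2 ∷ 2 ∷ 2 ∷ 2 ∷ 2 ∷ 2 ∷ 4 ∷ [])) ≡
      sum (map pred (invariantFactors₈ m)) + m
    -- With m = 1 + n every `pred` computes; `p`, `q` and `r` below are the resulting forms of 2m -
    -- 1, 4m - 1 and 6m - 1.
    count (suc n) = identity n
      where
      identity : ∀ n →
        let p = n + (1 + n + 0)
            q = n + (1 + n + (1 + n + (1 + n + 0)))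
            r = n + (1 + n + (1 + n + (1 + n + (1 + n + (1 + n + 0))))) in
        p + (p + (p + (p + (p + (p + (p + (q + 0))))))) ≡
        n + (n + (n + (p + (p + (p + (p + (r + 0))))))) + (1 + n)
      identity = ℕSolver.solve-∀

-- The groups of rank at least eight.

invariantFactors : ℕ → ℕ → List ℕ
invariantFactors s m = replicate s m ++ invariantFactors₈ m

-- When `ns` is a divisor chain of numbers above 1, this amounts to δ ≥ k.
HasLongSequence : ℕ → List ℕ → Set
HasLongSequence k ns = ∃ λ S → ZeroSumFree (⨁C ns) S × length S ≡ sum (map pred ns) + k

∷-hasLongSequence : ∀ {k} n .{{_ : NonZero n}} ns → HasLongSequence k ns → HasLongSequence k (n ∷ ns)
∷-hasLongSequence n ns (S , free , len) =
    withUnits n ns S , withUnits-zeroSumFree n ns free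
  , trans (length-withUnits n ns S) (trans (cong (λ l → pred n + l) len) (sym (ℕ.+-assoc (pred n) _ _)))

invariantFactors-hasLongSequence : ∀ s m .{{_ : NonZero m}} → HasLongSequence m (invariantFactors s m)
invariantFactors-hasLongSequence zero    m =
  sequence , sequence-zeroSumFree , length-sequence
  where open RankEight m
invariantFactors-hasLongSequence (suc s) m =
  ∷-hasLongSequence m (invariantFactors s m) (invariantFactors-hasLongSequence s m)

∣invariantFactors : ∀ s m → All (m ∣_) (invariantFactors s m)
∣invariantFactors s m = ++⁺ (replicate⁺ s ∣-refl)
  (∣-refl ∷ ∣-refl ∷ ∣-refl ∷ n∣m*n 2 ∷ n∣m*n 2 ∷ n∣m*n 2 ∷ n∣m*n 2 ∷ n∣m*n 6 ∷ [])

invariantFactors-linked : ∀ s m → Linked _∣_ (invariantFactors s m)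
invariantFactors-linked s m = go s
  where
  base : Linked _∣_ (invariantFactors₈ m)
  base = ∣-refl ∷ ∣-refl ∷ n∣m*n 2 ∷ ∣-refl ∷ ∣-refl ∷ ∣-refl ∷ *-monoˡ-∣ m (divides {2} {6} 3 refl) ∷ [-]
  go : ∀ s → Linked _∣_ (invariantFactors s m)
  go zero          = base
  go (suc zero)    = ∣-refl ∷ base
  go (suc (suc s)) = ∣-refl ∷ go (suc s)

length-invariantFactors : ∀ s m → length (invariantFactors s m) ≡ 8 + s
length-invariantFactors s m =
  trans (length-++ (replicate s m)) (trans (cong (λ l → l + 8) (length-replicate s)) (ℕ.+-comm s 8))

1<invariantFactors : ∀ s {m} → 1 < m → All (1 <_) (invariantFactors s m)
1<invariantFactors s {m} 1<m = ++⁺ (replicate⁺ s 1<m)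
  (1<m ∷ 1<m ∷ 1<m ∷ 1<k*m 2 ∷ 1<k*m 2 ∷ 1<k*m 2 ∷ 1<k*m 2 ∷ 1<k*m 6 ∷ [])
  where
  1<k*m : ∀ k .{{_ : NonZero k}} → 1 < k * m
  1<k*m k = ℕ.<-≤-trans 1<m (ℕ.m≤n*m m k)

HasLargeExcess : ℕ → ℕ → AbGroup → Set
HasLargeExcess m r G = IsFinite G × HasRank G r × Σ[ δ ∈ ℤ ] (HasExcess G δ × + m ℤ.≤ δ)

invariantFactors-large : ∀ s m → 1 < m → HasLargeExcess m (8 + s) (⨁C (invariantFactors s m))
invariantFactors-large s m 1<m =
  let instance _ = positive 1<m
      S , free , len = invariantFactors-hasLongSequence s m
      d , maximal    = Davenport.davenport G finite
      e+m≤d          = ℕ.≤-trans (ℕ.≤-reflexive (sym len)) (proj₂ maximal _ (S , (λ {T} → free {T}) , refl))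
  in finite
   , subst (HasRank G) (length-invariantFactors s m) (⨁C-rank 1<m (∣invariantFactors s m))
   , + d ℤ.- + e
   , (d , e , maximal , ⨁C-davenport* (1<invariantFactors s 1<m) (invariantFactors-linked s m) , refl)
   , excess≥ d e+m≤d
  where
  positive : ∀ {n} → 1 < n → NonZero n
  positive 1<n = >-nonZero (ℕ.<-trans (s≤s z≤n) 1<n)
  G = ⨁C (invariantFactors s m)
  e = sum (map pred (invariantFactors s m))
  finite : IsFinite G
  finite = _ , ⨁C-sized (All.map positive (1<invariantFactors s 1<m))
  excess≥ : ∀ d → e + m ≤ d → + m ℤ.≤ + d ℤ.- + e
  excess≥ d e+m≤d = begin
    + m             ≤⟨ ℤ.+≤+ (ℕ.m+n≤o⇒m≤o∸n m (subst (_≤ d) (ℕ.+-comm e m) e+m≤d)) ⟩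
    + (d ∸ e)       ≡⟨ ℤ.⊖-≥ (ℕ.m+n≤o⇒m≤o e e+m≤d) ⟨
    d ℤ.⊖ e         ≡⟨ ℤ.m-n≡m⊖n d e ⟨
    + d ℤ.- + e     ∎
    where open ℤ.≤-Reasoning

replicate-++-∷ : ∀ s (m : ℕ) L → m ∷ replicate s m ++ L ≡ replicate s m ++ m ∷ L
replicate-++-∷ zero    m L = refl
replicate-++-∷ (suc s) m L = cong (m ∷_) (replicate-++-∷ s m L)

G-large : ∀ {r m} → 8 ≤ r → 1 < m → HasLargeExcess m r G[ m , r ]
G-large {m = m} 8≤r 1<m with s , refl ← ℕ.m≤n⇒∃[o]m+o≡n 8≤r =
  subst (λ ns → HasLargeExcess m (8 + s) (⨁C ns)) (sym invariantFactors≡) (invariantFactors-large s m 1<m)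
  where
  shift = replicate-++-∷ s m
  L = replicate 4 (2 * m) ++ [ 6 * m ]
  -- For r = 8 + s the exponent r - 5 is 3 + s. Three copies of `m` are moved, one at a time, past
  -- the other s to meet the form of `invariantFactors₈`.
  invariantFactors≡ : replicate (3 + s) m ++ L ≡ invariantFactors s m
  invariantFactors≡ =
    trans (cong (λ ns → m ∷ m ∷ ns) (shift L)) (trans (cong (m ∷_) (shift (m ∷ L))) (shift (m ∷ m ∷ L)))

-- Unboundedness of the excess.

i≤+∣i∣ : ∀ i → i ℤ.≤ + ℤ.∣ i ∣
i≤+∣i∣ (+ n)    = ℤ.≤-refl
i≤+∣i∣ -[1+ n ] = ℤ.-≤+

-- For q = i/d with d ≥ 1 one has q ≤ |i|, so δ/k ≥ |i| + 1 is enough; this gives N = (|i| + 1)k.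
eventually-exceeds : ∀ q k .{{_ : NonZero k}} → ∃ λ N → ∀ {δ} → + N ℤ.≤ δ → q ℚ.< δ / k
eventually-exceeds q@(mkℚ i d-1 _) k@(suc k-1) = suc ℤ.∣ i ∣ * k , λ { {δ} (ℤ.+≤+ {n = n} N≤n) →
  -- Since `δ / k` is stored in lowest terms, the cross multiplication is done on the unnormalised
  -- fraction.
  ℚ.toℚᵘ-cancel-< (ℚᵘ.<-respʳ-≃ (ℚᵘ.≃-sym (ℚ.toℚᵘ-fromℚᵘ (mkℚᵘ δ k-1))) (*<* (begin-strict
    i ℤ.* + k                ≤⟨ ℤ.*-monoʳ-≤-nonNeg (+ k) (i≤+∣i∣ i) ⟩
    + ℤ.∣ i ∣ ℤ.* + k        ≡⟨ ℤ.pos-* ℤ.∣ i ∣ k ⟨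
    + (ℤ.∣ i ∣ * k)          <⟨ ℤ.+<+ (ℕ.m<n+m (ℤ.∣ i ∣ * k) (s≤s z≤n)) ⟩
    + (suc ℤ.∣ i ∣ * k)      ≤⟨ ℤ.+≤+ (ℕ.≤-trans N≤n (ℕ.m≤m*n n (suc d-1))) ⟩
    + (n * suc d-1)          ≡⟨ ℤ.pos-* n (suc d-1) ⟩
    + n ℤ.* + suc d-1        ∎))) }
  where open ℤ.≤-Reasoning

<ᵣ-<-trans : ∀ x {p q} → x <ᵣ p → p ℚ.< q → x <ᵣ q
<ᵣ-<-trans x {p} {q} x<p p<q = Equivalence.from (ℝ.upper-rounded x q) (p , p<q , x<p)

-- The upper cut of `b` contains some rational q, and the excess is at least m, so a large m
-- suffices. The divisor `k` serves both δ itself, with k = 1, and δ divided by the rank, with k =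
-- 8.
unbounded : ∀ {r} → 8 ≤ r → ∀ k .{{_ : NonZero k}} (b : ℝ) →
  ∃ λ m → 1 < m × Σ[ large ∈ HasLargeExcess m r G[ m , r ] ] b <ᵣ proj₁ (proj₂ (proj₂ large)) / k
unbounded 8≤r k b =
  let q , b<q = ℝ.upper-inhab b
      N , N-exceeds = eventually-exceeds q k
      -- Adding 2 secures 1 < m whatever N is.
      m = 2 + N
      1<m = s≤s (s≤s z≤n)
      large = G-large 8≤r 1<m
      _ , _ , _ , _ , m≤δ = large
  in m , 1<m , large , <ᵣ-<-trans b b<q (N-exceeds (ℤ.≤-trans (ℤ.+≤+ (ℕ.m≤n+m N 2)) m≤δ))

G₈-nontrivial : ∀ {m} → 1 < m → IsNontrivial G[ m , 8 ]
G₈-nontrivial {m} = ⨁C-nontrivial (m ∷ m ∷ replicate 4 (2 * m) ++ [ 6 * m ])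

corollary6p1 : (∀ r → 8 ≤ r →
    SupIsInfinite λ q → Σ[ G ∈ AbGroup ] Σ[ δ ∈ ℤ ]
    IsFinite G × HasRank G r × HasExcess G δ × q ≡ δ / 1)
    ×
    (¬ (Σ[ f ∈ (ℕ → ℝ) ]
    (∀ k → 0ℚ ≤ᵣ f k) ×
    (∀ G → IsFinite G → IsNontrivial G →
    ∀ r δ → HasRank G r → HasExcess G δ → (δ / 1) ≤ᵣ f r)))
    ×
    (SupIsInfinite λ q → Σ[ G ∈ AbGroup ] Σ[ δ ∈ ℤ ] Σ[ r ∈ ℕ ] Σ[ r≢0 ∈ NonZero r ]
    IsFinite G × IsNontrivial G × HasRank G r × HasExcess G δ ×
    q ≡ _/_ δ r {{r≢0}})
    ×
    (SupIsInfinite λ q → Σ[ G ∈ AbGroup ] Σ[ δ ∈ ℤ ]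
    IsFinite G × HasRank G 8 × HasExcess G δ × q ≡ δ / 8)
    ×
    (∀ r m → 8 ≤ r → 2 ≤ m → r ≤ m →
    IsFinite G[ m , r ] × HasRank G[ m , r ] r ×
    (Σ[ δ ∈ ℤ ] HasExcess G[ m , r ] δ × (+ r ℤ.- 1ℤ) ℤ.< δ))
corollary6p1 =
    (λ r 8≤r b →
      let m , _ , (finite , rank , δ , excess , _) , b<δ = unbounded 8≤r 1 b
      in δ / 1 , (G[ m , r ] , δ , finite , rank , excess , refl) , b<δ)
  -- The single value f(8) is already exceeded by the excess of a group of rank eight.
  , (λ (f , _ , bounds) →
      let m , 1<m , (finite , rank , δ , excess , _) , f8<δ = unbounded ℕ.≤-refl 1 (f 8)
      in bounds G[ m , 8 ] finite (G₈-nontrivial 1<m) 8 δ rank excess f8<δ)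
  , (λ b →
      let m , 1<m , (finite , rank , δ , excess , _) , b<δ/8 = unbounded ℕ.≤-refl 8 b
      in δ / 8 , (G[ m , 8 ] , δ , 8 , _ , finite , G₈-nontrivial 1<m , rank , excess , refl) , b<δ/8)
  , (λ b →
      let m , _ , (finite , rank , δ , excess , _) , b<δ/8 = unbounded ℕ.≤-refl 8 b
      in δ / 8 , (G[ m , 8 ] , δ , finite , rank , excess , refl) , b<δ/8)
  -- Matching `r` as a successor lets `+ r ℤ.- 1ℤ` compute, so `r≤m` itself proves r - 1 < m, and m
  -- ≤ δ finishes.
  , λ { r@(suc _) m 8≤r 2≤m r≤m →
      let finite , rank , δ , excess , m≤δ = G-large 8≤r 2≤m
      in finite , rank , δ , excess , ℤ.<-≤-trans (ℤ.+<+ r≤m) m≤δ }
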